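{- Let $G=(V,E)$ be an undirected graph with $m$ edges and let $k\ge 4$. Let $\gamma$ be the largest size that the set $V'$ takes in the algorithm $\mathrm{CommunityCliqueList}(G,k)$ described in the context. Then the cost of this algorithm, excluding the cost of preprocessing, is $$O\left(k\, m\left(\frac{\gamma+4-k}{2}\right)^{k-2}\right)$$ work and $O(k\log(\gamma+1))$ depth to list all $k$-cliques.
   Context: Model: CREW PRAM (shared memory, concurrent reads, exclusive writes). Work is the total number of elementary operations; depth is the length of a critical path. Graphs are assumed connected. A $k$-clique is a set of $k$ vertices inducing a complete graph. In an undirected graph $H$, the community $C_H(e)$ of an edge $e=\{u,v\}$ is the set of common neighbors of $u$ and $v$ in $H$. In a directed graph, the community of $e=(u,v)$ is $C(u,v)=N^+(u)\cap N^-(v)$, the out-neighbors of $u$ that are in-neighbors of $v$. For a total order $\preceq$ on $E$ and $e\in E$, $E[e\preceq]$ is the set of edges $f$ with $e\preceq f$. For a vertex set $I$ with a total order and $u,v\in I$, $\delta_I(u,v)$ is the number of elements of $I$ strictly between $u$ and $v$. Procedure $\mathrm{RecursiveCount}(D,I,c)$, for a graph $D$ oriented by a total vertex order (each edge directed from lower to higher endpoint), a vertex set $I$ and integer $c\ge 1$: if $c=1$, report one clique for every vertex of $I$; if $c=2$, report one clique for every edge of $D[I]$; if $c\ge3$, for all pairs $(u,v)\in I\times I$, with $u$ before $v$, such that $\delta_I(u,v)\ge c-2$: if $(u,v)$ is an edge of $D$, set $I'=I\cap C(u,v)$ and call $\mathrm{RecursiveCount}(D,I',c-2)$. Algorithm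 $\mathrm{CommunityCliqueList}(G,k)$: orient $G$ by an (arbitrary) total vertex order to obtain $D$; compute a total order $\preceq$ on the edges of $G$; then for all edges $e\in E$ in parallel, let $V'=C_{(V,E[e\preceq])}(e)$ and call $\mathrm{RecursiveCount}(D,V',k-2)$. Preprocessing comprises the computation of the orders, the construction of the sets $V'$ and of the (sorted) communities, and of lookup tables so that within the subgraphs handled by the recursion an edge test takes $O(1)$ work and an intersection $I\cap C(u,v)$ takes work linear in the sizes of the two sets and logarithmic depth. Reporting a $k$-clique costs $O(k)$ work.
   Formalization: The printed work bound is proved for γ ≥ k−1; it fails uniformly in k at γ = k−2 and can fail at γ ≤ k−3 (it is zero at γ = k−4), where O(k²m) and O(m) are proved instead; the depth bound is O(max(1, k log(γ+1))), since the printed one is zero at γ = 0. -}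

module Defs where

open import Data.Bool.Base using (if_then_else_)
open import Data.Fin.Base as Fin using (Fin)
import Data.Fin.Properties as Fin
open import Data.List.Base
  using (List; []; _∷_; _++_; length; map; filter; foldr; mapMaybe; allFin; cartesianProduct)
open import Data.List.Extrema.Nat using (max)
open import Data.List.Relation.Unary.AllPairs using (AllPairs)
open import Data.List.Relation.Unary.Any using (Any; any?)
open import Data.List.Relation.Unary.Unique.Propositional using (Unique)
open import Data.Maybe.Base using (Maybe; just; nothing)
open import Data.Nat.Base using (ℕ; suc; _+_; _*_; _∸_; _≤_; _⊔_)
open import Data.Nat.Logarithm using (⌊log₂_⌋)
import Data.Nat.Properties as ℕ
open import Data.Product.Base using (_×_; _,_; proj₁; proj₂)
open import Data.Sum.Base using (_⊎_)
open import Level using (0ℓ)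
open import Relation.Binary.Construct.Closure.ReflexiveTransitive using (Star)
open import Relation.Binary.Core using (Rel)
open import Relation.Binary.Definitions using (Decidable; Symmetric)
open import Relation.Binary.PropositionalEquality.Core using (_≡_)
open import Relation.Binary.Structures using (IsStrictTotalOrder; IsDecTotalOrder)
open import Relation.Nullary using (¬_; Dec; yes; no; does; _×-dec_; _⊎-dec_)
import Data.List.Membership.DecPropositional as DecMembership

record Graph : Set₁ where
  field
    n       : ℕ
    Adj     : Rel (Fin n) 0ℓ
    adj?    : Decidable Adj
    adj-sym : Symmetric Adj
    loopless : ∀ {v} → ¬ Adj v v

  Vertex : Set
  Vertex = Fin n

open Graph using (Vertex)

Connected : Graph → Set
Connected G = ∀ u v → Star (Graph.Adj G) u v

-- The edge {u , v} is stored once, with its endpoints in the built-in order of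
-- Fin n; this is unrelated to the vertex order that orients the graph.  The
-- proofs are irrelevant, so equality of edges is equality of endpoints.
record Edge (G : Graph) : Set where
  constructor edge
  field
    lo hi  : Vertex G
    .lo<hi : lo Fin.< hi
    .adj   : Graph.Adj G lo hi

open Edge using (lo; hi)

toEdge : (G : Graph) → Vertex G × Vertex G → Maybe (Edge G)
toEdge G (u , v) with u Fin.<? v | Graph.adj? G u v
... | yes u<v | yes uv = just (edge u v u<v uv)
... | yes _   | no _   = nothing
... | no _    | _      = nothing

edges : (G : Graph) → List (Edge G)
edges G = mapMaybe (toEdge G) (cartesianProduct (allFin _) (allFin _))

#edges : Graph → ℕ
#edges G = length (edges G)

IsClique : (G : Graph) → ℕ → List (Vertex G) → Set
IsClique G k K = length K ≡ k × Unique K × AllPairs (Graph.Adj G) K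

-- Adjacency and communities in the subgraph (V , F).

module _ {G : Graph} where

  Joins : Vertex G → Vertex G → Edge G → Set
  Joins u v f = (lo f ≡ u × hi f ≡ v) ⊎ (lo f ≡ v × hi f ≡ u)

  joins? : ∀ u v f → Dec (Joins u v f)
  joins? u v f = (lo f Fin.≟ u ×-dec hi f Fin.≟ v) ⊎-dec (lo f Fin.≟ v ×-dec hi f Fin.≟ u)

  AdjIn : List (Edge G) → Vertex G → Vertex G → Set
  AdjIn F u v = Any (Joins u v) F

  adjIn? : ∀ F → Decidable (AdjIn F)
  adjIn? F u v = any? (joins? u v) F

  communityIn : List (Edge G) → Edge G → List (Vertex G)
  communityIn F e = filter (λ w → adjIn? F (lo e) w ×-dec adjIn? F (hi e) w) (allFin _)

record VertexOrder (G : Graph) : Set₁ where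
  field
    _≺_                : Rel (Vertex G) 0ℓ
    isStrictTotalOrder : IsStrictTotalOrder _≡_ _≺_

  open IsStrictTotalOrder isStrictTotalOrder public using () renaming (_<?_ to _≺?_)

record EdgeOrder (G : Graph) : Set₁ where
  field
    _⪯_             : Rel (Edge G) 0ℓ
    isDecTotalOrder : IsDecTotalOrder _≡_ _⪯_

  open IsDecTotalOrder isDecTotalOrder public using () renaming (_≤?_ to _⪯?_)

module _ {G : Graph} (O : EdgeOrder G) where

  open EdgeOrder O

  E[_⪯] : Edge G → List (Edge G)
  E[ e ⪯] = filter (e ⪯?_) (edges G)

  V′ : Edge G → List (Vertex G)
  V′ e = communityIn E[ e ⪯] e

  γ : ℕ
  γ = max 0 (map (λ e → length (V′ e)) (edges G))

record Cost : Set where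
  constructor ⟨_,_⟩
  field
    work depth : ℕ

open Cost public

-- Costs of the primitives.  A call of RecursiveCount has a fixed cost, which
-- includes setting up its parallel loop; a depth independent of the number of
-- iterations is the PRAM convention.  The cost of an intersection depends on
-- the sizes of the two sets, that of a report on the number of vertices.
record CostModel : Set where
  field
    call edgeTest : Cost
    intersection  : ℕ → ℕ → Cost
    report        : ℕ → Cost
    α             : ℕ
    intersection-work  : ∀ a b → work  (intersection a b) ≤ α * (1 + a + b)
    intersection-depth : ∀ a b → depth (intersection a b) ≤ α * (1 + ⌊log₂ (1 + a + b) ⌋)
    report-work        : ∀ k → work  (report k) ≤ α * k
    report-depth       : ∀ k → depth (report k) ≤ α * k

record Run (A : Set) : Set where
  constructor run
  field
    reports : List A
    cost    : Cost

open Run public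

module _ {A : Set} where

  idle : Run A
  idle = run [] ⟨ 0 , 0 ⟩

  infixr 5 _⨾_
  infixr 4 _∥_

  _⨾_ : Cost → Run A → Run A
  c ⨾ r = run (reports r) ⟨ work c + work (cost r) , depth c + depth (cost r) ⟩

  _∥_ : Run A → Run A → Run A
  r ∥ s = run (reports r ++ reports s)
              ⟨ work (cost r) + work (cost s) , depth (cost r) ⊔ depth (cost s) ⟩

  forAll : {B : Set} → List B → (B → Run A) → Run A
  forAll xs f = foldr (λ x r → f x ∥ r) idle xs

module Algorithm (M : CostModel) (G : Graph) (O : VertexOrder G) where

  open CostModel M
  open Graph G using (Adj; adj?)
  open VertexOrder O
  open DecMembership (Fin._≟_ {Graph.n G}) using (_∈?_)

  Arc : Rel (Vertex G) 0ℓ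
  Arc u v = u ≺ v × Adj u v

  arc? : Decidable Arc
  arc? u v = u ≺? v ×-dec adj? u v

  -- N⁺(u) ∩ N⁻(v) in the subgraph of D induced by S.
  community : List (Vertex G) → Vertex G → Vertex G → List (Vertex G)
  community S u v = filter (λ w → arc? u w ×-dec arc? w v) S

  infixl 7 _∩_
  _∩_ : List (Vertex G) → List (Vertex G) → List (Vertex G)
  I ∩ C = filter (_∈? C) I

  δ : List (Vertex G) → Vertex G → Vertex G → ℕ
  δ I u v = length (filter (λ w → u ≺? w ×-dec w ≺? v) I)

  -- The pairs u before v of I × I with δ_I(u , v) ≥ d.
  pairs : List (Vertex G) → ℕ → List (Vertex G × Vertex G)
  pairs I d = filter (λ p → (proj₁ p ≺? proj₂ p) ×-dec (d ℕ.≤? δ I (proj₁ p) (proj₂ p)))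
                     (cartesianProduct I I)

  reportClique : List (Vertex G) → Run (List (Vertex G))
  reportClique K = report (length K) ⨾ run (K ∷ []) ⟨ 0 , 0 ⟩

  -- S is the set passed to the outermost call.  The precomputed communities are
  -- those of D[S]: since I ⊆ S, intersecting I with the community taken in D
  -- gives the same set, but only the community in D[S] has size bounded by γ.
  -- K holds the vertices already fixed by the enclosing calls, so that whole
  -- cliques are reported.  The clause for c = 0 is never reached from c ≥ 1.
  recursiveCount : (S K I : List (Vertex G)) → ℕ → Run (List (Vertex G))
  recursiveCount S K I 0 = idle
  recursiveCount S K I 1 = call ⨾ forAll I (λ w → reportClique (w ∷ K))
  recursiveCount S K I 2 = call ⨾ forAll (pairs I 0) λ (u , v) →
    edgeTest ⨾ (if does (arc? u v) then reportClique (u ∷ v ∷ K) else idle)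
  recursiveCount S K I (suc (suc (suc c))) = call ⨾ forAll (pairs I (suc c)) λ (u , v) →
    edgeTest ⨾ (if does (arc? u v)
      then intersection (length I) (length (community S u v)) ⨾
           recursiveCount S (u ∷ v ∷ K) (I ∩ community S u v) (suc c)
      else idle)

  -- Only what follows the preprocessing is charged: the two orders, the sets
  -- V′ e and the communities are available at no cost.
  communityCliqueList : EdgeOrder G → ℕ → Run (List (Vertex G))
  communityCliqueList P k = forAll (edges G) λ e →
    recursiveCount (V′ P e) (lo e ∷ hi e ∷ []) (V′ P e) (k ∸ 2)

open Algorithm public using (communityCliqueList)

{-# OPTIONS --safe #-}

-- For each j < |I| exactly one vertex of a set I has j predecessors in I, so the sum of
-- f (δ_I (u , v)) over the pairs u ≺ v of I is the double prefix sum Σ_{r < |I|} Σ_{j < r} f j.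
-- A pair with δ_I (u , v) = j leads to a call on at most j vertices; hence every level of the
-- recursion, which lowers c by 2, takes two more prefix sums of the constant 1.  With
-- l = |I| - c, the number of cliques reported is therefore at most the binomial
-- coefficient of l + c over c, and as its successive ratios (l + c + 1) / (c + 1) are at most
-- (l + 2) / 2 for c ≥ 1, it is at most 2 ((l + 2) / 2) ^ c; at the top l + 2 = γ + 4 - k.  If
-- l + 2 ≥ 3 the same powers sum to a constant times the last one, which pays for the linear
-- cost of the intersections at all levels.
--
-- A clique is listed by the call for its ⪯-least edge: the other vertices then lie in V′, and
-- each level removes the least and the greatest of them, which have the rest between them.

module Submission where

open import Defs
open import Data.Bool.Base using (true; false; if_then_else_)
import Data.Fin.Base as Fin
import Data.Fin.Properties as Fin
open import Data.List.Base
  using (List; []; _∷_; [_]; _++_; _∷ʳ_; length; map; filter; cartesianProduct; allFin; initLast; _∷ʳ′_)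
import Data.List.Extrema as Extrema
open import Data.List.Extrema.Nat using (xs≤max)
import Data.List.Membership.DecPropositional as DecMembership
open import Data.List.Membership.Propositional using (_∈_; find; lose)
open import Data.List.Membership.Propositional.Properties
  using (∈-∃++; ∈-allFin; ∈-cartesianProduct⁺; ∈-cartesianProduct⁻; ∈-filter⁺; ∈-filter⁻)
open import Data.List.Properties
  using (++-assoc; filter-++; filter-all; filter-reject; length-++; length-filter; map-++; map-cong; map-cong-local)
open import Data.List.Relation.Binary.Permutation.Propositional
  using (_↭_; prep; ↭-refl; ↭-sym; ↭-trans; ↭⇒↭ₛ; module PermutationReasoning)
open import Data.List.Relation.Binary.Permutation.Propositional.Properties
  using (++-comm; All-resp-↭; filter-↭; ∈-resp-↭; ↭-length)
  renaming (map⁺ to ↭-map⁺; shift to ↭-shift)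
import Data.List.Relation.Binary.Permutation.Setoid.Properties as Permutationₛ
open import Data.List.Relation.Unary.All as All using (All; []; _∷_)
import Data.List.Relation.Unary.All.Properties as All
open import Data.List.Relation.Unary.AllPairs as AllPairs using (AllPairs; []; _∷_)
open import Data.List.Relation.Unary.Any as Any using (Any; here; there)
import Data.List.Relation.Unary.Any.Properties as Any
open import Data.List.Relation.Unary.Sorted.TotalOrder.Properties using (Sorted⇒AllPairs)
open import Data.List.Relation.Unary.Unique.Propositional using (Unique)
open import Data.List.Relation.Unary.Unique.Propositional.Properties
  using (allFin⁺) renaming (filter⁺ to Unique-filter⁺)
import Data.List.Sort as Sort
import Data.Maybe.Relation.Unary.Any as Maybe
open import Data.Nat.Base
open import Data.Nat.ListAction using (sum)
open import Data.Nat.ListAction.Properties using (sum-++; sum-↭)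
open import Data.Nat.Logarithm using (⌊log₂_⌋; ⌊log₂⌋-mono-≤; ⌊log₂[2*b]⌋≡1+⌊log₂b⌋)
open import Data.Nat.Properties
open import Data.Nat.Tactic.RingSolver using (solve-∀)
open import Data.Product.Base using (_×_; _,_; proj₁; proj₂; ∃-syntax)
open import Data.Sum.Base using (inj₁; inj₂)
open import Function.Base using (_∘_; flip; id)
open import Level using (0ℓ)
open import Relation.Binary.Bundles using (DecTotalOrder; StrictTotalOrder; TotalOrder)
import Relation.Binary.Construct.Flip.EqAndOrd as Flip
open import Relation.Binary.Core using (Rel)
open import Relation.Binary.Definitions using (Decidable; Symmetric; tri<; tri≈; tri>)
import Relation.Binary.Properties.StrictTotalOrder as StrictTotalOrderProperties
open import Relation.Binary.PropositionalEquality hiding ([_])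
open import Relation.Binary.Structures using (IsDecTotalOrder; IsStrictTotalOrder)
open import Relation.Nullary using (Dec; yes; no; does; contradiction; recompute; _×-dec_)
open import Relation.Nullary.Decidable using (dec-true)
import Relation.Unary as Unary

-- Prefix sums

sumBelow : ℕ → (ℕ → ℕ) → ℕ
sumBelow zero    f = 0
sumBelow (suc n) f = f n + sumBelow n f

sumBelow-mono : ∀ {f g} → (∀ i → f i ≤ g i) → ∀ n → sumBelow n f ≤ sumBelow n g
sumBelow-mono f≤g zero    = z≤n
sumBelow-mono f≤g (suc n) = +-mono-≤ (f≤g n) (sumBelow-mono f≤g n)

sumBelow-cong : ∀ {f g} → (∀ i → f i ≡ g i) → ∀ n → sumBelow n f ≡ sumBelow n g
sumBelow-cong f≡g zero    = refl
sumBelow-cong f≡g (suc n) = cong₂ _+_ (f≡g n) (sumBelow-cong f≡g n)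

sumBelow-monoˡ : ∀ f {m n} → m ≤ n → sumBelow m f ≤ sumBelow n f
sumBelow-monoˡ f m≤n = go (≤⇒≤′ m≤n)
  where
  go : ∀ {m n} → m ≤′ n → sumBelow m f ≤ sumBelow n f
  go (≤′-reflexive refl) = ≤-refl
  go (≤′-step m≤n)       = m≤n⇒m≤o+n (f _) (go m≤n)

-- The definition splits off the largest index; offsets are removed at the bottom, which needs the
-- smallest index split off.
sumBelow-suc : ∀ f n → sumBelow (suc n) f ≡ f 0 + sumBelow n (f ∘ suc)
sumBelow-suc f zero    = refl
sumBelow-suc f (suc n) = begin
  f (suc n) + sumBelow (suc n) f                ≡⟨ cong (f (suc n) +_) (sumBelow-suc f n) ⟩
  f (suc n) + (f 0 + sumBelow n (f ∘ suc))      ≡⟨ x∙yz≈y∙xz (f (suc n)) (f 0) _ ⟩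
  f 0 + (f (suc n) + sumBelow n (f ∘ suc))      ∎
  where
  open ≡-Reasoning
  x∙yz≈y∙xz : ∀ x y z → x + (y + z) ≡ y + (x + z)
  x∙yz≈y∙xz = solve-∀

-- Subtraction is truncated, so the first `d` indices all contribute `F 0`. In the application `F`
-- is itself a prefix sum, and `F 0` is an empty sum.
sumBelow-∸ : ∀ {F} → F 0 ≡ 0 → ∀ d n → sumBelow n (λ r → F (r ∸ d)) ≡ sumBelow (n ∸ d) F
sumBelow-∸ F0 zero    n       = refl
sumBelow-∸ F0 (suc d) zero    = refl
sumBelow-∸ {F} F0 (suc d) (suc n) = begin
  sumBelow (suc n) (λ r → F (r ∸ suc d))  ≡⟨ sumBelow-suc (λ r → F (r ∸ suc d)) n ⟩
  F 0 + sumBelow n (λ r → F (r ∸ d))      ≡⟨ cong₂ _+_ F0 (sumBelow-∸ F0 d n) ⟩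
  sumBelow (n ∸ d) F                      ∎
  where open ≡-Reasoning

-- The weights of the loop over pairs, which vanish below the threshold d on δ.
shift : ℕ → (ℕ → ℕ) → ℕ → ℕ
shift zero    h j       = h j
shift (suc d) h zero    = 0
shift (suc d) h (suc j) = shift d h j

shift-≥ : ∀ {d j} h → d ≤ j → shift d h j ≡ h (j ∸ d)
shift-≥ h z≤n       = refl
shift-≥ h (s≤s d≤j) = shift-≥ h d≤j

sumBelow-shift : ∀ d h n → sumBelow n (shift d h) ≡ sumBelow (n ∸ d) h
sumBelow-shift zero    h n       = refl
sumBelow-shift (suc d) h zero    = refl
sumBelow-shift (suc d) h (suc n) = trans (sumBelow-suc (shift (suc d) h) n) (sumBelow-shift d h n)

-- In a sum over the pairs u ≺ v of an ordered set, `r` is the number of elements above u and the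
-- inner index is the number of elements between u and v.
sumBelow² : ℕ → (ℕ → ℕ) → ℕ
sumBelow² n f = sumBelow n λ r → sumBelow r f

-- A threshold `d` on δ thus has the effect of deleting `d` elements from the set: the inner sum is
-- shortened first, then the outer one.
sumBelow²-shift : ∀ d h n → sumBelow² n (shift d h) ≡ sumBelow² (n ∸ d) h
sumBelow²-shift d h n = trans (sumBelow-cong (sumBelow-shift d h) n) (sumBelow-∸ refl d n)

-- Sums and lengths of filtered lists

module _ {A : Set} where

  sum-map-mono : ∀ {f g : A → ℕ} {xs} → All (λ x → f x ≤ g x) xs → sum (map f xs) ≤ sum (map g xs)
  sum-map-mono []       = z≤n
  sum-map-mono (p ∷ ps) = +-mono-≤ p (sum-map-mono ps)

  sum-map-const : ∀ c (xs : List A) → sum (map (λ _ → c) xs) ≡ length xs * c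
  sum-map-const c []       = refl
  sum-map-const c (x ∷ xs) = cong (c +_) (sum-map-const c xs)

  module _ {P Q : Unary.Pred A 0ℓ} (P? : Unary.Decidable P) (Q? : Unary.Decidable Q) where

    sum-filter-mono : (∀ {x} → P x → Q x) → ∀ (f : A → ℕ) xs →
                      sum (map f (filter P? xs)) ≤ sum (map f (filter Q? xs))
    sum-filter-mono P⇒Q f []       = z≤n
    sum-filter-mono P⇒Q f (x ∷ xs) with P? x | Q? x
    ... | yes p | yes q = +-monoʳ-≤ (f x) (sum-filter-mono P⇒Q f xs)
    ... | yes p | no ¬q = contradiction (P⇒Q p) ¬q
    ... | no ¬p | yes q = m≤n⇒m≤o+n (f x) (sum-filter-mono P⇒Q f xs)
    ... | no ¬p | no ¬q = sum-filter-mono P⇒Q f xs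

    length-filter-mono : (∀ {x} → P x → Q x) → ∀ xs → length (filter P? xs) ≤ length (filter Q? xs)
    length-filter-mono P⇒Q xs =
      subst₂ _≤_ (count (filter P? xs)) (count (filter Q? xs)) (sum-filter-mono P⇒Q (λ _ → 1) xs)
      where
      count : ∀ ys → sum (map (λ _ → 1) ys) ≡ length ys
      count ys = trans (sum-map-const 1 ys) (*-identityʳ (length ys))

    -- Allows δ to be read in two stages: first keep the elements above u, then count those of them
    -- below v.
    filter-× : ∀ xs → filter (λ x → P? x ×-dec Q? x) xs ≡ filter Q? (filter P? xs)
    filter-× []       = refl
    filter-× (x ∷ xs) with P? x
    ... | no _  = filter-× xs
    ... | yes _ with Q? x
    ...   | yes _ = cong (x ∷_) (filter-× xs)
    ...   | no _  = filter-× xs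

  module _ {R : Rel A 0ℓ} (R? : Decidable R) where

    sum-filter-cartesianProduct : ∀ (f : A × A → ℕ) xs ys →
      sum (map f (filter (λ p → R? (proj₁ p) (proj₂ p)) (cartesianProduct xs ys)))
      ≡ sum (map (λ u → sum (map (λ v → f (u , v)) (filter (R? u) ys))) xs)
    sum-filter-cartesianProduct f []       ys = refl
    sum-filter-cartesianProduct f (x ∷ xs) ys = begin
      sum (map f (filter R?₂ (map (x ,_) ys ++ cartesianProduct xs ys)))
        ≡⟨ cong (sum ∘ map f) (filter-++ R?₂ (map (x ,_) ys) _) ⟩
      sum (map f (filter R?₂ (map (x ,_) ys) ++ filter R?₂ (cartesianProduct xs ys)))
        ≡⟨ cong sum (map-++ f (filter R?₂ (map (x ,_) ys)) _) ⟩
      sum (map f (filter R?₂ (map (x ,_) ys)) ++ map f (filter R?₂ (cartesianProduct xs ys)))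
        ≡⟨ sum-++ (map f (filter R?₂ (map (x ,_) ys))) _ ⟩
      sum (map f (filter R?₂ (map (x ,_) ys))) + sum (map f (filter R?₂ (cartesianProduct xs ys)))
        ≡⟨ cong₂ _+_ (row ys) (sum-filter-cartesianProduct f xs ys) ⟩
      sum (map (λ u → sum (map (λ v → f (u , v)) (filter (R? u) ys))) (x ∷ xs)) ∎
      where
      open ≡-Reasoning
      R?₂ = λ p → R? (proj₁ p) (proj₂ p)

      row : ∀ zs → sum (map f (filter R?₂ (map (x ,_) zs)))
                 ≡ sum (map (λ v → f (x , v)) (filter (R? x) zs))
      row []       = refl
      row (z ∷ zs) with does (R? x z)
      ... | true  = cong (f (x , z) +_) (row zs)
      ... | false = row zs

-- Ranks in a strictly ordered set

module _ {A : Set} {_<_ : Rel A 0ℓ} (<-sto : IsStrictTotalOrder _≡_ _<_) where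

  private
    module < = IsStrictTotalOrder <-sto
    strictTotalOrder : StrictTotalOrder 0ℓ 0ℓ 0ℓ
    strictTotalOrder = record { isStrictTotalOrder = <-sto }
    open StrictTotalOrderProperties strictTotalOrder using (decTotalOrder)
    open Sort decTotalOrder using (sort; sort-↭; sort-↗)

  sort-strictly : ∀ {xs} → Unique xs → ∃[ ys ] xs ↭ ys × AllPairs _<_ ys
  sort-strictly {xs} xs! = sort xs , xs↭ys ,
    AllPairs.zipWith strict
      (Sorted⇒AllPairs (DecTotalOrder.totalOrder decTotalOrder) (sort-↗ xs)
      , Permutationₛ.Unique-resp-↭ (setoid A) (↭⇒↭ₛ xs↭ys) xs!)
    where
    xs↭ys = ↭-sym (sort-↭ xs)
    strict : ∀ {x y} → DecTotalOrder._≤_ decTotalOrder x y × x ≢ y → x < y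
    strict (inj₁ x<y , _)   = x<y
    strict (inj₂ x≡y , x≢y) = contradiction x≡y x≢y

  module _ (_<?_ : Decidable _<_) where

    private
      above : List A → A → ℕ
      above xs u = length (filter (u <?_) xs)

    -- The head of a sorted list has the whole tail above it and is above no element of the tail, so
    -- it contributes exactly the term that `sumBelow` splits off.
    sum-above-sorted : ∀ f {xs} → AllPairs _<_ xs → sum (map (f ∘ above xs) xs) ≡ sumBelow (length xs) f
    sum-above-sorted f []                            = refl
    sum-above-sorted f {x ∷ xs} (x<xs ∷ xs↗) = cong₂ _+_
      (cong (f ∘ length) (trans (filter-reject (x <?_) (<.irrefl refl)) (filter-all (x <?_) x<xs)))
      (trans (cong sum (map-cong-local (All.map above-tail x<xs))) (sum-above-sorted f xs↗))
      where
      above-tail : ∀ {v} → x < v → f (above (x ∷ xs) v) ≡ f (above xs v)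
      above-tail {v} x<v = cong (f ∘ length) (filter-reject (v <?_) (<.asym x<v))

    sum-above : ∀ f {xs} → Unique xs → sum (map (f ∘ above xs) xs) ≡ sumBelow (length xs) f
    sum-above f {xs} xs! with ys , xs↭ys , ys↗ ← sort-strictly xs! = begin
      sum (map (f ∘ above xs) xs) ≡⟨ cong sum (map-cong (λ u → cong f (↭-length (filter-↭ (u <?_) xs↭ys))) xs) ⟩
      sum (map (f ∘ above ys) xs) ≡⟨ sum-↭ (↭-map⁺ (f ∘ above ys) xs↭ys) ⟩
      sum (map (f ∘ above ys) ys) ≡⟨ sum-above-sorted f ys↗ ⟩
      sumBelow (length ys) f      ≡⟨ cong (λ n → sumBelow n f) (↭-length xs↭ys) ⟨
      sumBelow (length xs) f      ∎
      where open ≡-Reasoning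

-- Iterated prefix sums and their bounds

sumBelow-+ : ∀ f g n → sumBelow n (λ i → f i + g i) ≡ sumBelow n f + sumBelow n g
sumBelow-+ f g zero    = refl
sumBelow-+ f g (suc n) =
  trans (cong (f n + g n +_) (sumBelow-+ f g n)) (interchange (f n) (g n) _ _)
  where
  interchange : ∀ a b x y → (a + b) + (x + y) ≡ (a + x) + (b + y)
  interchange = solve-∀

sumBelow-* : ∀ a f n → sumBelow n (λ i → a * f i) ≡ a * sumBelow n f
sumBelow-* a f zero    = sym (*-zeroʳ a)
sumBelow-* a f (suc n) = trans (cong (a * f n +_) (sumBelow-* a f n)) (sym (*-distribˡ-+ a (f n) _))

sumBelow-≤ : ∀ f {x} n → (∀ {i} → i < n → f i ≤ x) → sumBelow n f ≤ n * x
sumBelow-≤ f zero    f≤x = z≤n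
sumBelow-≤ f (suc n) f≤x = +-mono-≤ (f≤x ≤-refl) (sumBelow-≤ f n (f≤x ∘ m≤n⇒m≤1+n))

prefixSum : (ℕ → ℕ) → ℕ → ℕ
prefixSum f l = sumBelow (suc l) f

-- The two elements of the pair itself account for the offset: the outer index 0 has an empty inner
-- sum, and dropping it makes both sums inclusive.
sumBelow²-prefixSum : ∀ f l → sumBelow² (2 + l) f ≡ prefixSum (prefixSum f) l
sumBelow²-prefixSum f l = sumBelow-suc (λ r → sumBelow r f) (suc l)

-- multichoose c l is the binomial coefficient of l + c over c.
multichoose : ℕ → ℕ → ℕ
multichoose zero    l = 1
multichoose (suc c) l = prefixSum (multichoose c) l

-- geometric c l is the sum of multichoose i l over all i ≤ c (see geometric-suc).
geometric : ℕ → ℕ → ℕ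
geometric zero    l = 1
geometric (suc c) l = suc (prefixSum (geometric c) l)

multichoose-1 : ∀ l → multichoose 1 l ≡ suc l
multichoose-1 zero    = refl
multichoose-1 (suc l) = cong suc (multichoose-1 l)

multichoose-0 : ∀ c → multichoose c 0 ≡ 1
multichoose-0 zero    = refl
multichoose-0 (suc c) = trans (+-identityʳ _) (multichoose-0 c)

geometric-0 : ∀ c → geometric c 0 ≡ suc c
geometric-0 zero    = refl
geometric-0 (suc c) = cong suc (trans (+-identityʳ _) (geometric-0 c))

multichoose-suc-≤ : ∀ c l → multichoose c l ≤ multichoose c (suc l)
multichoose-suc-≤ zero    l = ≤-refl
multichoose-suc-≤ (suc c) l = m≤n+m _ (multichoose c (suc l))

multichoose-mono : ∀ c {i j} → i ≤′ j → multichoose c i ≤ multichoose c j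
multichoose-mono c (≤′-reflexive refl)  = ≤-refl
multichoose-mono c {j = suc j} (≤′-step i≤j) =
  ≤-trans (multichoose-mono c i≤j) (multichoose-suc-≤ c j)

-- Prefix sums are additive, and the prefix sum of `multichoose c` is `multichoose (suc c)`, so the
-- induction hypothesis can be summed term by term.
geometric-suc : ∀ c l → geometric (suc c) l ≡ geometric c l + multichoose (suc c) l
geometric-suc zero    l = refl
geometric-suc (suc c) l = cong suc (trans
  (sumBelow-cong (geometric-suc c) (suc l))
  (sumBelow-+ (geometric c) (multichoose (suc c)) (suc l)))

-- The prefix sum up to `l` has 1 + l terms, none larger than the term that is added next.
multichoose-growthˡ : ∀ c l → (2 + l) * multichoose (suc c) l ≤ (1 + l) * multichoose (suc c) (suc l)
multichoose-growthˡ c l = begin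
  multichoose (suc c) l + (1 + l) * multichoose (suc c) l
    ≤⟨ +-monoˡ-≤ _ (sumBelow-≤ (multichoose c) (suc l)
         (λ i<1+l → multichoose-mono c (≤⇒≤′ (<⇒≤ i<1+l)))) ⟩
  (1 + l) * multichoose c (suc l) + (1 + l) * multichoose (suc c) l
    ≡⟨ *-distribˡ-+ (1 + l) (multichoose c (suc l)) _ ⟨
  (1 + l) * multichoose (suc c) (suc l) ∎
  where open ≤-Reasoning

-- Induction on `l`: the step adds `X` to the sum on the left, and `multichoose-growthˡ` bounds what
-- the induction hypothesis leaves by (1 + l) `X`.
multichoose-growth : ∀ c l → 2 * multichoose (2 + c) l ≤ (2 + l) * multichoose (suc c) l
multichoose-growth c zero    = ≤-reflexive (cong (2 *_)
  (trans (multichoose-0 (2 + c)) (sym (multichoose-0 (suc c)))))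
multichoose-growth c (suc l) = begin
  2 * (X + multichoose (2 + c) l)          ≡⟨ *-distribˡ-+ 2 X _ ⟩
  2 * X + 2 * multichoose (2 + c) l        ≤⟨ +-monoʳ-≤ (2 * X) (multichoose-growth c l) ⟩
  2 * X + (2 + l) * multichoose (suc c) l  ≤⟨ +-monoʳ-≤ (2 * X) (multichoose-growthˡ c l) ⟩
  2 * X + (1 + l) * X                      ≡⟨ *-distribʳ-+ X 2 (1 + l) ⟨
  (3 + l) * X                              ∎
  where
  open ≤-Reasoning
  X = multichoose (suc c) (suc l)

-- The factor 2 pays for the step from 0 to 1, where the ratio is 1 + l; from there on every ratio
-- is at most (2 + l) / 2.
multichoose-bound : ∀ c l → 2 ^ c * multichoose c l ≤ 2 * (2 + l) ^ c
multichoose-bound zero          l = s≤s z≤n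
multichoose-bound (suc zero)    l = begin
  2 * multichoose 1 l  ≡⟨ cong (2 *_) (multichoose-1 l) ⟩
  2 * (1 + l)          ≤⟨ *-monoʳ-≤ 2 (≤-trans (n≤1+n (1 + l)) (≤-reflexive (sym (*-identityʳ (2 + l))))) ⟩
  2 * (2 + l) ^ 1      ∎
  where open ≤-Reasoning
multichoose-bound (suc (suc c)) l = begin
  2 * 2 ^ (suc c) * multichoose (2 + c) l          ≡⟨ swap² 2 (2 ^ suc c) _ ⟩
  2 ^ (suc c) * (2 * multichoose (2 + c) l)        ≤⟨ *-monoʳ-≤ (2 ^ suc c) (multichoose-growth c l) ⟩
  2 ^ (suc c) * ((2 + l) * multichoose (suc c) l)  ≡⟨ swap³ (2 ^ suc c) (2 + l) _ ⟩
  (2 + l) * (2 ^ (suc c) * multichoose (suc c) l)  ≤⟨ *-monoʳ-≤ (2 + l) (multichoose-bound (suc c) l) ⟩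
  (2 + l) * (2 * (2 + l) ^ suc c)                  ≡⟨ swap³ (2 + l) 2 ((2 + l) ^ suc c) ⟩
  2 * (2 + l) ^ (2 + c)                            ∎
  where
  open ≤-Reasoning
  swap² : ∀ x y z → x * y * z ≡ y * (x * z)
  swap² = solve-∀
  swap³ : ∀ x y z → x * (y * z) ≡ y * (x * z)
  swap³ = solve-∀

-- With `suc l` the ratio of the powers is (3 + l) / 2, at least 3 / 2, so their sum is at most 3
-- times the last one; with the 2 of `multichoose-bound` this gives 6.
geometric-bound : ∀ c l → 2 ^ c * geometric c (suc l) ≤ 6 * (3 + l) ^ c
geometric-bound zero    l = s≤s z≤n
geometric-bound (suc c) l = begin
  2 ^ suc c * geometric (suc c) (suc l)
    ≡⟨ cong (2 ^ suc c *_) (geometric-suc c (suc l)) ⟩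
  2 ^ suc c * (geometric c (suc l) + multichoose (suc c) (suc l))
    ≡⟨ split (2 ^ c) (geometric c (suc l)) (multichoose (suc c) (suc l)) ⟩
  2 * (2 ^ c * geometric c (suc l)) + 2 ^ suc c * multichoose (suc c) (suc l)
    ≤⟨ +-mono-≤ (*-monoʳ-≤ 2 (geometric-bound c l)) (multichoose-bound (suc c) (suc l)) ⟩
  2 * (6 * (3 + l) ^ c) + 2 * (3 + l) ^ suc c
    -- The gap 6 (3 + l) - 2 (3 + l) - 12 is 4 l, nonnegative because the base is at least 3.
    ≤⟨ m≤m+n _ (4 * l * (3 + l) ^ c) ⟩
  2 * (6 * (3 + l) ^ c) + 2 * (3 + l) ^ suc c + 4 * l * (3 + l) ^ c
    ≡⟨ collect l ((3 + l) ^ c) ⟩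
  6 * (3 + l) ^ suc c ∎
  where
  open ≤-Reasoning
  split : ∀ p x y → 2 * p * (x + y) ≡ 2 * (p * x) + 2 * p * y
  split = solve-∀
  collect : ∀ l t → 2 * (6 * t) + 2 * ((3 + l) * t) + 4 * l * t ≡ 6 * ((3 + l) * t)
  collect = solve-∀

-- Fixing a pair lowers the number of missing vertices by 2 and lengthens `K` by 2; the size of the
-- clique is unchanged.
pair-+ : ∀ c m → suc c + (2 + m) ≡ 3 + c + m
pair-+ = solve-∀

-- Work and depth of parallel loops

module _ {A : Set} where

  if-elim : {P : Set} (B : Run A → Set) (P? : Dec P) {r : Run A} →
            (P → B r) → B idle → B (if does P? then r else idle)
  if-elim B (yes p) r b = r p
  if-elim B (no _)  r b = b

  module _ {B : Set} {f : B → Run A} where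

    forAll-work : ∀ {g : B → ℕ} {xs} → All (λ x → work (cost (f x)) ≤ g x) xs →
                  work (cost (forAll xs f)) ≤ sum (map g xs)
    forAll-work []       = z≤n
    forAll-work (p ∷ ps) = +-mono-≤ p (forAll-work ps)

    forAll-depth : ∀ {d xs} → All (λ x → depth (cost (f x)) ≤ d) xs →
                   depth (cost (forAll xs f)) ≤ d
    forAll-depth []       = z≤n
    forAll-depth (p ∷ ps) = ⊔-lub p (forAll-depth ps)

-- Costs of the recursion

module Costs (M : CostModel) (G : Graph) (O : VertexOrder G) where

  open Algorithm M G O hiding (communityCliqueList)
  open CostModel M
  open Graph using (Vertex)
  open VertexOrder O
  open DecMembership (Fin._≟_ {Graph.n G}) using (_∈?_)

  private
    δ′ : List (Vertex G) → Vertex G × Vertex G → ℕ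
    δ′ I (u , v) = δ I u v

    pairs? : ∀ I d → Unary.Decidable (λ p → (proj₁ p ≺ proj₂ p) × (d ≤ δ′ I p))
    pairs? I d p = (proj₁ p ≺? proj₂ p) ×-dec (d ≤? δ′ I p)

  sum-pairs : ∀ {I} → Unique I → ∀ d f →
              sum (map (λ p → f (δ′ I p)) (pairs I d)) ≤ sumBelow² (length I) f
  sum-pairs {I} I! d f = begin
    sum (map (λ p → f (δ′ I p)) (pairs I d))
      ≤⟨ sum-filter-mono (pairs? I d) (λ p → proj₁ p ≺? proj₂ p) proj₁ (f ∘ δ′ I) (cartesianProduct I I) ⟩
    _ ≡⟨ sum-filter-cartesianProduct _≺?_ (f ∘ δ′ I) I I ⟩
    sum (map (λ u → sum (map (λ v → f (δ I u v)) (filter (u ≺?_) I))) I)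
      ≤⟨ sum-map-mono (All.universal (≤-reflexive ∘ row) I) ⟩
    sum (map (λ u → sumBelow (length (filter (u ≺?_) I)) f) I)
      ≡⟨ sum-above isStrictTotalOrder _≺?_ (λ r → sumBelow r f) I! ⟩
    sumBelow² (length I) f ∎
    where
    open ≤-Reasoning
    row : ∀ u → sum (map (λ v → f (δ I u v)) (filter (u ≺?_) I))
              ≡ sumBelow (length (filter (u ≺?_) I)) f
    row u = trans
      (cong sum (map-cong (λ v → cong (f ∘ length) (filter-× (u ≺?_) (_≺? v) I)) (filter (u ≺?_) I)))
      -- The order is reversed, since for fixed u the elements counted by δ are those below v.
      (sum-above (Flip.isStrictTotalOrder isStrictTotalOrder) (flip _≺?_) f (Unique-filter⁺ (u ≺?_) I!))

  pairs-δ : ∀ I d → All (λ p → d ≤ δ′ I p) (pairs I d)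
  pairs-δ I d = All.map proj₂ (All.all-filter (pairs? I d) (cartesianProduct I I))

  -- `sum-pairs` forgets the threshold, so it is moved into the weights: `shift d h` agrees with the
  -- summand on the pairs kept and is 0 on the others.
  sum-pairs-∸ : ∀ {I} → Unique I → ∀ d h →
                sum (map (λ p → h (δ′ I p ∸ d)) (pairs I d)) ≤ sumBelow² (length I ∸ d) h
  sum-pairs-∸ {I} I! d h = begin
    sum (map (λ p → h (δ′ I p ∸ d)) (pairs I d))
      ≤⟨ sum-map-mono (All.map (≤-reflexive ∘ sym ∘ shift-≥ h) (pairs-δ I d)) ⟩
    sum (map (λ p → shift d h (δ′ I p)) (pairs I d))
      ≤⟨ sum-pairs I! d (shift d h) ⟩
    sumBelow² (length I) (shift d h)
      ≡⟨ sumBelow²-shift d h (length I) ⟩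
    sumBelow² (length I ∸ d) h ∎
    where open ≤-Reasoning

  -- Here `l` is the excess of the set over c = 2 + d. The next call has c = d and at most δ
  -- vertices, so `δ′ I p ∸ d` bounds its excess.
  sum-pairs-prefixSum : ∀ {I} → Unique I → ∀ d h {l} → length I ≤ l + (2 + d) →
    sum (map (λ p → h (δ′ I p ∸ d)) (pairs I d)) ≤ prefixSum (prefixSum h) l
  sum-pairs-prefixSum {I} I! d h {l} I≤ = begin
    _                          ≤⟨ sum-pairs-∸ I! d h ⟩
    sumBelow² (length I ∸ d) h ≤⟨ sumBelow-monoˡ _ (m≤n+o⇒m∸n≤o (length I) d
                                     (≤-trans I≤ (≤-reflexive (rearrange l d)))) ⟩
    sumBelow² (2 + l) h        ≡⟨ sumBelow²-prefixSum h l ⟩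
    prefixSum (prefixSum h) l  ∎
    where
    open ≤-Reasoning
    rearrange : ∀ l d → l + (2 + d) ≡ d + (2 + l)
    rearrange = solve-∀

  -- A pair with `d` elements between needs d + 2 elements. This is read off from the sum of the
  -- weight 1, bounded by `sumBelow²` at 1, which is 0.
  pairs-empty : ∀ {I} → Unique I → ∀ {d} → length I ≤ suc d → pairs I d ≡ []
  pairs-empty {I} I! {d} I≤ = length≤0 (pairs I d) (begin
    length (pairs I d)                   ≡⟨ trans (sum-map-const 1 (pairs I d)) (*-identityʳ _) ⟨
    sum (map (λ _ → 1) (pairs I d))      ≤⟨ sum-pairs-∸ I! d (λ _ → 1) ⟩
    sumBelow² (length I ∸ d) (λ _ → 1)   ≤⟨ sumBelow-monoˡ _ (m≤n+o⇒m∸n≤o (length I) d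
                                              (≤-trans I≤ (≤-reflexive (+-comm 1 d)))) ⟩
    0                                    ∎)
    where
    open ≤-Reasoning
    length≤0 : ∀ {B : Set} (xs : List B) → length xs ≤ 0 → xs ≡ []
    length≤0 [] _ = refl

  -- Arcs go upwards in the vertex order, so a community lies strictly between its endpoints.
  length-∩-community : ∀ S I u v → length (I ∩ community S u v) ≤ δ I u v
  length-∩-community S I u v = length-filter-mono _ _ between I
    where
    between : ∀ {w} → w ∈ community S u v → (u ≺ w) × (w ≺ v)
    between w∈C with (u≺w , _) , (w≺v , _) ← proj₂ (∈-filter⁻ _ {xs = S} w∈C) = u≺w , w≺v

  module _ {S : List (Vertex G)} {s k : ℕ} (|S|≤s : length S ≤ s) where

    -- `Q` is charged for a call together with the pair that leads to it, `R` for a report with its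
    -- edge test. Both sets of an intersection have size at most `s` at every level.
    private
      pairCost = work edgeTest + α * (1 + (s + s))
      Q = work call + pairCost
      R = work edgeTest + α * k

    intersection-work-≤ : ∀ (I : List (Vertex G)) u v → length I ≤ s →
      work edgeTest + work (intersection (length I) (length (community S u v))) ≤ pairCost
    intersection-work-≤ I u v I≤s = +-monoʳ-≤ (work edgeTest) (≤-trans (intersection-work _ _)
      (*-monoʳ-≤ α (s≤s (+-mono-≤ I≤s (≤-trans (length-filter _ S) |S|≤s)))))

    report-work-≤ : ∀ (K : List (Vertex G)) → length K ≡ k → work (cost (reportClique K)) ≤ α * k
    report-work-≤ K refl = ≤-trans (≤-reflexive (+-identityʳ _)) (report-work k)

    -- The summand pairCost pays for the edge test and the intersection that precede the call.
    recursiveCount-work : ∀ c (K I : List (Vertex G)) → Unique I → length I ≤ s → suc c + length K ≡ k →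
      ∀ {l} → length I ≤ l + suc c →
      pairCost + work (cost (recursiveCount S K I (suc c))) ≤ Q * geometric c l + R * multichoose (suc c) l
    recursiveCount-work zero K I I! I≤s K≡ {l} I≤ = begin
      pairCost + (work call + work (cost (forAll I _)))  ≤⟨ +-monoʳ-≤ pairCost (+-monoʳ-≤ (work call)
                                                              (forAll-work (All.universal
                                                                (λ w → ≤-trans (report-work-≤ (w ∷ K) K≡) (m≤n+m _ _)) I))) ⟩
      pairCost + (work call + sum (map (λ _ → R) I))     ≡⟨ cong (λ x → pairCost + (work call + x)) (sum-map-const R I) ⟩
      pairCost + (work call + length I * R)              ≡⟨ rearrange pairCost (work call) (length I) R ⟩
      Q * 1 + R * length I                               ≤⟨ +-monoʳ-≤ (Q * 1) (*-monoʳ-≤ R I≤) ⟩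
      Q * 1 + R * (l + 1)                                ≡⟨ cong (λ x → Q * 1 + R * x)
                                                              (trans (+-comm l 1) (sym (multichoose-1 l))) ⟩
      Q * 1 + R * multichoose 1 l                        ∎
      where
      open ≤-Reasoning
      rearrange : ∀ p c i r → p + (c + i * r) ≡ (c + p) * 1 + r * i
      rearrange = solve-∀
    recursiveCount-work (suc zero) K I I! I≤s K≡ {l} I≤ = begin
      pairCost + (work call + work (cost (forAll (pairs I 0) _)))
        ≤⟨ +-monoʳ-≤ pairCost (+-monoʳ-≤ (work call) (forAll-work (All.universal leaf (pairs I 0)))) ⟩
      pairCost + (work call + sum (map (λ _ → R * 1) (pairs I 0)))
        ≤⟨ +-monoʳ-≤ pairCost (+-monoʳ-≤ (work call) (sum-pairs-prefixSum I! 0 (λ _ → R * 1) I≤)) ⟩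
      pairCost + (work call + prefixSum (prefixSum (λ _ → R * 1)) l)
        ≡⟨ cong (λ x → pairCost + (work call + x)) (trans
             (sumBelow-cong (λ i → sumBelow-* R (λ _ → 1) (suc i)) (suc l))
             (sumBelow-* R (multichoose 1) (suc l))) ⟩
      pairCost + (work call + R * multichoose 2 l)
        ≡⟨ rearrange pairCost (work call) (R * multichoose 2 l) ⟩
      Q * 1 + R * multichoose 2 l
        ≤⟨ +-monoˡ-≤ (R * multichoose 2 l) (*-monoʳ-≤ Q (s≤s z≤n)) ⟩
      Q * geometric 1 l + R * multichoose 2 l ∎
      where
      open ≤-Reasoning
      rearrange : ∀ p c x → p + (c + x) ≡ (c + p) * 1 + x
      rearrange = solve-∀
      leaf : ∀ p → work edgeTest + work (cost (if does (arc? (proj₁ p) (proj₂ p))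
                     then reportClique (proj₁ p ∷ proj₂ p ∷ K) else idle)) ≤ R * 1
      leaf (u , v) = ≤-trans (+-monoʳ-≤ (work edgeTest)
        (if-elim (λ r → work (cost r) ≤ α * k) (arc? u v) (λ _ → report-work-≤ (u ∷ v ∷ K) K≡) z≤n))
        (≤-reflexive (sym (*-identityʳ R)))
    recursiveCount-work (suc (suc c)) K I I! I≤s K≡ {l} I≤ = begin
      pairCost + (work call + work (cost (forAll (pairs I (suc c)) _)))
        ≤⟨ +-monoʳ-≤ pairCost (+-monoʳ-≤ (work call) (forAll-work (All.map (λ {p} → branch p) (pairs-δ I (suc c))))) ⟩
      pairCost + (work call + sum (map (λ p → h (δ′ I p ∸ suc c)) (pairs I (suc c))))
        ≤⟨ +-monoʳ-≤ pairCost (+-monoʳ-≤ (work call) (sum-pairs-prefixSum I! (suc c) h I≤)) ⟩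
      pairCost + (work call + prefixSum (prefixSum h) l)
        ≡⟨ cong (λ x → pairCost + (work call + x)) (trans
             (sumBelow-cong (λ i → linear (geometric c) (multichoose (suc c)) (suc i)) (suc l))
             (linear (prefixSum (geometric c)) (multichoose (2 + c)) (suc l))) ⟩
      pairCost + (work call + (Q * prefixSum (prefixSum (geometric c)) l + R * multichoose (3 + c) l))
        ≡⟨ rearrange pairCost (work call) (prefixSum (prefixSum (geometric c)) l) (R * multichoose (3 + c) l) ⟩
      Q * suc (prefixSum (prefixSum (geometric c)) l) + R * multichoose (3 + c) l
        -- The recursion lowers c by 2, while `geometric` counts every level; the skipped level is
        -- slack.
        ≤⟨ +-monoˡ-≤ (R * multichoose (3 + c) l) (*-monoʳ-≤ Q
             (s≤s (sumBelow-mono (λ i → n≤1+n _) (suc l)))) ⟩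
      Q * geometric (2 + c) l + R * multichoose (3 + c) l ∎
      where
      open ≤-Reasoning
      h : ℕ → ℕ
      h j = Q * geometric c j + R * multichoose (suc c) j

      linear : ∀ f g n → sumBelow n (λ i → Q * f i + R * g i) ≡ Q * sumBelow n f + R * sumBelow n g
      linear f g n = trans (sumBelow-+ (λ i → Q * f i) (λ i → R * g i) n)
                           (cong₂ _+_ (sumBelow-* Q f n) (sumBelow-* R g n))

      rearrange : ∀ p c x y → p + (c + ((c + p) * x + y)) ≡ (c + p) * (1 + x) + y
      rearrange = solve-∀

      branch : ∀ p → suc c ≤ δ′ I p →
        work edgeTest + work (cost (if does (arc? (proj₁ p) (proj₂ p))
          then intersection (length I) (length (community S (proj₁ p) (proj₂ p))) ⨾
               recursiveCount S (proj₁ p ∷ proj₂ p ∷ K) (I ∩ community S (proj₁ p) (proj₂ p)) (suc c)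
          else idle)) ≤ h (δ′ I p ∸ suc c)
      branch (u , v) d≤δ = if-elim (λ r → work edgeTest + work (cost r) ≤ h (δ I u v ∸ suc c)) (arc? u v)
        (λ _ → begin
          work edgeTest + (work (intersection (length I) (length (community S u v))) + rest)
            ≡⟨ +-assoc (work edgeTest) _ rest ⟨
          work edgeTest + work (intersection (length I) (length (community S u v))) + rest
            ≤⟨ +-monoˡ-≤ rest (intersection-work-≤ I u v I≤s) ⟩
          pairCost + rest
            ≤⟨ recursive ⟩
          h (δ I u v ∸ suc c) ∎)
        -- If the pair is not an arc, only the edge test is paid; the bound for the call that is not
        -- made covers it.
        (≤-trans (+-monoʳ-≤ (work edgeTest) z≤n) (≤-trans (m≤m+n _ _) recursive))
        where
        I′ = I ∩ community S u v
        rest = work (cost (recursiveCount S (u ∷ v ∷ K) I′ (suc c)))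
        recursive : pairCost + rest ≤ h (δ I u v ∸ suc c)
        recursive = recursiveCount-work c (u ∷ v ∷ K) I′ (Unique-filter⁺ _ I!)
          (≤-trans (length-filter (_∈? community S u v) I) I≤s) (trans (pair-+ c (length K)) K≡)
          -- The truncated subtraction is exact because the pair has passed the threshold.
          (≤-trans (length-∩-community S I u v) (≤-reflexive (sym (m∸n+n≡m d≤δ))))

    private
      X = depth call + (depth edgeTest + α * (1 + ⌊log₂ (1 + (s + s)) ⌋))

    -- Iterations run in parallel, so a path meets one pair per level and one report. A level costs
    -- at most `X` and lowers c by 2; charging `X` for each unit of c is enough.
    recursiveCount-depth : ∀ c (K I : List (Vertex G)) → length I ≤ s → suc c + length K ≡ k →
      depth (cost (recursiveCount S K I (suc c))) ≤ suc c * X + α * k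
    recursiveCount-depth c K I I≤s K≡ = body c K≡
      where
      open ≤-Reasoning

      report-depth-≤ : ∀ (K : List (Vertex G)) → length K ≡ k → depth (cost (reportClique K)) ≤ α * k
      report-depth-≤ K refl = ≤-trans (≤-reflexive (+-identityʳ _)) (report-depth k)

      call+edgeTest : ∀ {d} → d ≤ α * k → depth call + (depth edgeTest + d) ≤ X + α * k
      call+edgeTest {d} d≤ = begin
        depth call + (depth edgeTest + d)      ≡⟨ +-assoc (depth call) _ d ⟨
        depth call + depth edgeTest + d        ≤⟨ +-mono-≤ (+-monoʳ-≤ (depth call) (m≤m+n _ _)) d≤ ⟩
        X + α * k                              ∎

      body : ∀ c → suc c + length K ≡ k → depth (cost (recursiveCount S K I (suc c))) ≤ suc c * X + α * k
      body zero K≡ = begin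
        depth call + depth (cost (forAll I _))  ≤⟨ +-monoʳ-≤ (depth call)
                                                     (forAll-depth (All.universal (λ w → report-depth-≤ (w ∷ K) K≡) I)) ⟩
        depth call + α * k                      ≤⟨ +-monoˡ-≤ (α * k) (≤-trans (m≤m+n _ _) (m≤m+n X 0)) ⟩
        1 * X + α * k                           ∎
      body (suc zero) K≡ = begin
        depth call + depth (cost (forAll (pairs I 0) _))
          ≤⟨ +-monoʳ-≤ (depth call) (forAll-depth {d = depth edgeTest + α * k} (All.universal
               (λ { (u , v) → +-monoʳ-≤ (depth edgeTest) (if-elim (λ r → depth (cost r) ≤ α * k) (arc? u v)
                      (λ _ → report-depth-≤ (u ∷ v ∷ K) K≡) z≤n) })
               (pairs I 0))) ⟩
        depth call + (depth edgeTest + α * k)  ≤⟨ call+edgeTest ≤-refl ⟩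
        X + α * k                              ≤⟨ +-monoˡ-≤ (α * k) (m≤m+n X _) ⟩
        2 * X + α * k                          ∎
      body (suc (suc c)) K≡ = begin
        depth call + depth (cost (forAll (pairs I (suc c)) _))
          ≤⟨ +-monoʳ-≤ (depth call) (forAll-depth {d = depth edgeTest + (Λ + (suc c * X + α * k))}
               (All.universal branch (pairs I (suc c)))) ⟩
        depth call + (depth edgeTest + (Λ + (suc c * X + α * k)))
          ≡⟨ rearrange (depth call) (depth edgeTest) Λ (suc c * X) (α * k) ⟩
        X + suc c * X + α * k
          ≤⟨ +-monoˡ-≤ (α * k) (m≤n+m _ X) ⟩
        (3 + c) * X + α * k ∎
        where
        Λ = α * (1 + ⌊log₂ (1 + (s + s)) ⌋)

        rearrange : ∀ a b l y z → a + (b + (l + (y + z))) ≡ a + (b + l) + y + z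
        rearrange = solve-∀

        branch : ∀ p → depth edgeTest + depth (cost (if does (arc? (proj₁ p) (proj₂ p))
            then intersection (length I) (length (community S (proj₁ p) (proj₂ p))) ⨾
                 recursiveCount S (proj₁ p ∷ proj₂ p ∷ K) (I ∩ community S (proj₁ p) (proj₂ p)) (suc c)
            else idle)) ≤ depth edgeTest + (Λ + (suc c * X + α * k))
        branch (u , v) = +-monoʳ-≤ (depth edgeTest)
          (if-elim (λ r → depth (cost r) ≤ Λ + (suc c * X + α * k)) (arc? u v)
            (λ _ → +-mono-≤
              (≤-trans (intersection-depth _ _) (*-monoʳ-≤ α (s≤s (⌊log₂⌋-mono-≤
                (s≤s (+-mono-≤ I≤s (≤-trans (length-filter _ S) |S|≤s)))))))
              (recursiveCount-depth c (u ∷ v ∷ K) (I ∩ community S u v)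
                (≤-trans (length-filter (_∈? community S u v) I) I≤s) (trans (pair-+ c (length K)) K≡)))
            z≤n)

  -- No pair passes the threshold in so small a set, so the loop is empty and only the call is paid.
  recursiveCount-idle : ∀ c S K {I} → Unique I → length I ≤ suc c →
    cost (recursiveCount S K I (2 + c)) ≡ ⟨ work call + 0 , depth call + 0 ⟩
  recursiveCount-idle zero    S K I! I≤ rewrite pairs-empty I! I≤ = refl
  recursiveCount-idle (suc c) S K I! I≤ rewrite pairs-empty I! I≤ = refl

-- Arithmetic of the work bounds

module _ where
  open ≤-Reasoning

  -- A factor of at least 1 absorbs the constants beside it; it will be a size, the number k or a
  -- logarithm.
  x+y+z[1+n]≤a[1+n] : ∀ x y z {a} n → x + (y + z) ≤ a → x + (y + z * suc n) ≤ a * suc n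
  x+y+z[1+n]≤a[1+n] x y z {a} n ≤a = begin
    x + (y + z * suc n)                ≤⟨ m≤m+n _ ((x + y) * n) ⟩
    x + (y + z * suc n) + (x + y) * n  ≡⟨ rearrange x y z n ⟩
    (x + (y + z)) * suc n              ≤⟨ *-monoˡ-≤ (suc n) ≤a ⟩
    a * suc n                          ∎
    where
    rearrange : ∀ x y z n → x + (y + z * suc n) + (x + y) * n ≡ (x + (y + z)) * suc n
    rearrange = solve-∀

  -- 26 = 2 * 2 * 6 + 2: the geometric sum, of constant 6, comes with 2 q ≤ 4 a (3 + l) (3 + c),
  -- and the reports have the constant 2 of multichoose-bound.
  2^c-work-bound : ∀ a {q r} c l → let g = 1 + l + (1 + c) in
    q ≤ a * (1 + (g + g)) → r ≤ a * (3 + c) →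
    2 ^ suc c * (q * geometric c (suc l) + r * multichoose (suc c) (suc l))
      ≤ 26 * a * ((3 + c) * (3 + l) ^ suc c)
  2^c-work-bound a {q} {r} c l q≤ r≤ = begin
    2 ^ suc c * (q * geometric c (suc l) + r * multichoose (suc c) (suc l))
      ≡⟨ split (2 ^ c) q r (geometric c (suc l)) (multichoose (suc c) (suc l)) ⟩
    2 * q * (2 ^ c * geometric c (suc l)) + r * (2 ^ suc c * multichoose (suc c) (suc l))
      ≤⟨ +-mono-≤ (*-mono-≤ (*-monoʳ-≤ 2 q≤′) (geometric-bound c l))
                  (*-mono-≤ r≤ (multichoose-bound (suc c) (suc l))) ⟩
    2 * (a * (2 * (3 + l) * (3 + c))) * (6 * (3 + l) ^ c) + a * (3 + c) * (2 * (3 + l) ^ suc c)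
      ≡⟨ collect a (3 + l) (3 + c) ((3 + l) ^ c) ⟩
    26 * a * ((3 + c) * (3 + l) ^ suc c) ∎
    where
    split : ∀ p q r x y → 2 * p * (q * x + r * y) ≡ 2 * q * (p * x) + r * (2 * p * y)
    split = solve-∀
    collect : ∀ a t k x → 2 * (a * (2 * t * k)) * (6 * x) + a * k * (2 * (t * x)) ≡ 26 * a * (k * (t * x))
    collect = solve-∀
    slack : ∀ l c → 1 + ((1 + l + (1 + c)) + (1 + l + (1 + c))) + (13 + 4 * l + 4 * c + 2 * l * c)
                  ≡ 2 * (3 + l) * (3 + c)
    slack = solve-∀
    -- The linear cost of an intersection is split into a product: 3 + l raises the exponent of the
    -- geometric bound from c to 1 + c, and 3 + c is k.
    q≤′ : q ≤ a * (2 * (3 + l) * (3 + c))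
    q≤′ = ≤-trans q≤ (*-monoʳ-≤ a (≤-trans (m≤m+n _ _) (≤-reflexive (slack l c))))

  -- At excess 0 the powers have ratio 1, so `geometric` is linear in c; with the linear cost of the
  -- intersections this gives the square of k = 3 + c.
  boundary-work-bound : ∀ a {q r} c → let g = 1 + c in
    q ≤ a * (1 + (g + g)) → r ≤ a * (3 + c) →
    q * geometric c 0 + r * multichoose (suc c) 0 ≤ 26 * a * ((3 + c) * (3 + c))
  boundary-work-bound a {q} {r} c q≤ r≤ = begin
    q * geometric c 0 + r * multichoose (suc c) 0
      ≡⟨ cong₂ (λ x y → q * x + r * y) (geometric-0 c) (multichoose-0 (suc c)) ⟩
    q * suc c + r * 1
      ≤⟨ +-mono-≤ (*-monoˡ-≤ (suc c) q≤) (*-monoˡ-≤ 1 r≤) ⟩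
    a * (1 + (suc c + suc c)) * suc c + a * (3 + c) * 1
      ≤⟨ m≤m+n _ _ ⟩
    _ ≡⟨ slack a c ⟩
    26 * a * ((3 + c) * (3 + c)) ∎
    where
    slack : ∀ a c → a * (1 + (suc c + suc c)) * suc c + a * (3 + c) * 1
                    + a * (228 + 150 * c + 24 * c * c)
                  ≡ 26 * a * ((3 + c) * (3 + c))
    slack = solve-∀

-- Total work and depth

module _ {G : Graph} (P : EdgeOrder G) where

  V′-unique : ∀ e → Unique (V′ P e)
  V′-unique e = Unique-filter⁺ _ (allFin⁺ _)

  length-V′≤γ : All (λ e → length (V′ P e) ≤ γ P) (edges G)
  length-V′≤γ = All.map⁻ (xs≤max 0 (map (λ e → length (V′ P e)) (edges G)))

module TotalCost (M : CostModel) where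
  open CostModel M

  -- Work and depth constants are added so that a single constant, depending on the cost model
  -- alone, serves both bounds.
  A : ℕ
  A = (work call + (work edgeTest + α)) + (depth call + (depth edgeTest + α))

  private
    work≤A : work call + (work edgeTest + α) ≤ A
    work≤A = m≤m+n _ _

    depth≤A : depth call + (depth edgeTest + α) ≤ A
    depth≤A = m≤n+m _ (work call + (work edgeTest + α))

    A≤26A : A ≤ 26 * A
    A≤26A = m≤m+n A _

  module _ (G : Graph) (O : VertexOrder G) (P : EdgeOrder G) where
    open Algorithm M G O hiding (communityCliqueList)
    open Costs M G O
    open Edge using (lo; hi)
    open ≤-Reasoning

    private
      m = #edges G
      g = γ P

      subcall : ℕ → Edge G → Run _
      subcall c e = recursiveCount (V′ P e) (lo e ∷ hi e ∷ []) (V′ P e) c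

    total-work-≤ : ∀ c x → All (λ e → work (cost (subcall c e)) ≤ x) (edges G) →
                   work (cost (communityCliqueList M G O P (2 + c))) ≤ m * x
    total-work-≤ c x ≤x = ≤-trans (forAll-work ≤x) (≤-reflexive (sum-map-const x (edges G)))

    subcall-work : ∀ c l → g ≤ l + suc c → All (λ e → work (cost (subcall (suc c) e)) ≤
        (work call + (work edgeTest + α * (1 + (g + g)))) * geometric c l
        + (work edgeTest + α * (3 + c)) * multichoose (suc c) l) (edges G)
    subcall-work c l g≤ = All.map
      -- The summand `pairCost` is dropped: no intersection precedes an outermost call.
      (λ {e} ≤g → ≤-trans (m≤n+m _ _) (recursiveCount-work ≤g c (lo e ∷ hi e ∷ []) (V′ P e)
         (V′-unique P e) ≤g (+-comm (suc c) 2) (≤-trans ≤g g≤)))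
      (length-V′≤γ P)

    private
      q≤ : ∀ {g′} → g ≡ g′ → work call + (work edgeTest + α * (1 + (g + g))) ≤ A * (1 + (g′ + g′))
      q≤ g≡ = ≤-trans (x+y+z[1+n]≤a[1+n] (work call) (work edgeTest) α (g + g) work≤A)
                      (≤-reflexive (cong (λ g′ → A * (1 + (g′ + g′))) g≡))

      r≤ : ∀ c → work edgeTest + α * (3 + c) ≤ A * (3 + c)
      r≤ c = x+y+z[1+n]≤a[1+n] 0 (work edgeTest) α (2 + c) (≤-trans (m≤n+m _ (work call)) work≤A)

    work-bound : ∀ c l → g ≡ 1 + l + (1 + c) →
      work (cost (communityCliqueList M G O P (3 + c))) * 2 ^ suc c
        ≤ 26 * A * ((3 + c) * m * (3 + l) ^ suc c)
    work-bound c l g≡ = begin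
      work (cost (communityCliqueList M G O P (3 + c))) * 2 ^ suc c
        ≤⟨ *-monoˡ-≤ (2 ^ suc c) (total-work-≤ (suc c) x (subcall-work c (suc l) (≤-reflexive g≡))) ⟩
      m * x * 2 ^ suc c
        ≡⟨ trans (*-assoc m x _) (cong (m *_) (*-comm x _)) ⟩
      m * (2 ^ suc c * x)
        ≤⟨ *-monoʳ-≤ m (2^c-work-bound A c l (q≤ g≡) (r≤ c)) ⟩
      m * (26 * A * ((3 + c) * (3 + l) ^ suc c))
        ≡⟨ rearrange m (26 * A) (3 + c) ((3 + l) ^ suc c) ⟩
      26 * A * ((3 + c) * m * (3 + l) ^ suc c) ∎
      where
      x = (work call + (work edgeTest + α * (1 + (g + g)))) * geometric c (suc l)
          + (work edgeTest + α * (3 + c)) * multichoose (suc c) (suc l)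
      rearrange : ∀ m a k t → m * (a * (k * t)) ≡ a * (k * m * t)
      rearrange = solve-∀

    boundary-work : ∀ c → g ≡ 1 + c →
      work (cost (communityCliqueList M G O P (3 + c))) ≤ 26 * A * ((3 + c) * ((3 + c) * m))
    boundary-work c g≡ = begin
      work (cost (communityCliqueList M G O P (3 + c)))
        ≤⟨ total-work-≤ (suc c) _ (subcall-work c 0 (≤-reflexive g≡)) ⟩
      m * _
        ≤⟨ *-monoʳ-≤ m (boundary-work-bound A c (q≤ g≡) (r≤ c)) ⟩
      m * (26 * A * ((3 + c) * (3 + c)))
        ≡⟨ rearrange m (26 * A) (3 + c) ⟩
      26 * A * ((3 + c) * ((3 + c) * m)) ∎
      where
      rearrange : ∀ m a k → m * (a * (k * k)) ≡ a * (k * (k * m))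
      rearrange = solve-∀

    private
      subcall-idle : ∀ c → g ≤ suc c →
        All (λ e → cost (subcall (2 + c) e) ≡ ⟨ work call + 0 , depth call + 0 ⟩) (edges G)
      subcall-idle c g≤ = All.map
        (λ {e} ≤g → recursiveCount-idle c (V′ P e) _ (V′-unique P e) (≤-trans ≤g g≤))
        (length-V′≤γ P)

      x+0≤ : ∀ x {y} → x + y ≤ A → x + 0 ≤ 26 * A
      x+0≤ x ≤A = ≤-trans (+-monoʳ-≤ x z≤n) (≤-trans ≤A A≤26A)

    idle-work : ∀ c → g ≤ suc c → work (cost (communityCliqueList M G O P (4 + c))) ≤ 26 * A * m
    idle-work c g≤ = ≤-trans
      (total-work-≤ (2 + c) (26 * A)
        (All.map (λ eq → ≤-trans (≤-reflexive (cong work eq)) (x+0≤ (work call) work≤A)) (subcall-idle c g≤)))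
      (≤-reflexive (*-comm m _))

    idle-depth : ∀ c → g ≤ suc c → depth (cost (communityCliqueList M G O P (4 + c))) ≤ 26 * A
    idle-depth c g≤ = forAll-depth
      (All.map (λ eq → ≤-trans (≤-reflexive (cong depth eq)) (x+0≤ (depth call) depth≤A)) (subcall-idle c g≤))

    depth-bound : ∀ c → 1 ≤ g →
      depth (cost (communityCliqueList M G O P (3 + c))) ≤ 26 * A * ((3 + c) * ⌊log₂ (g + 1) ⌋)
    depth-bound c 1≤g = begin
      depth (cost (communityCliqueList M G O P (3 + c)))
        ≤⟨ forAll-depth (All.map (λ {e} ≤g → recursiveCount-depth ≤g c (lo e ∷ hi e ∷ []) (V′ P e)
             ≤g (+-comm (suc c) 2)) (length-V′≤γ P)) ⟩
      suc c * (depth call + (depth edgeTest + α * (1 + ⌊log₂ (1 + (g + g)) ⌋))) + α * (3 + c)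
        ≤⟨ +-mono-≤ (*-monoʳ-≤ (suc c) (x+y+z[1+n]≤a[1+n] (depth call) (depth edgeTest) α _ depth≤A))
                    (*-monoˡ-≤ (3 + c) (≤-trans (m≤n+m α (depth edgeTest))
                                       (≤-trans (m≤n+m _ (depth call)) depth≤A))) ⟩
      suc c * (A * (1 + ⌊log₂ (1 + (g + g)) ⌋)) + A * (3 + c)
        ≤⟨ +-mono-≤ (*-monoʳ-≤ (suc c) (*-monoʳ-≤ A log≤)) (*-monoʳ-≤ A k≤k*L) ⟩
      suc c * (A * (L + 2 * L)) + A * ((3 + c) * L)
        ≤⟨ m≤m+n _ _ ⟩
      _ ≡⟨ slack A c L ⟩
      26 * A * ((3 + c) * L) ∎
      where
      L = ⌊log₂ (g + 1) ⌋

      -- This is where `1 ≤ g` enters: once the logarithm is at least 1 it absorbs all additive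
      -- constants.
      1≤L : 1 ≤ L
      1≤L = ⌊log₂⌋-mono-≤ (+-monoˡ-≤ 1 1≤g)

      k≤k*L : 3 + c ≤ (3 + c) * L
      k≤k*L = ≤-trans (≤-reflexive (sym (*-identityʳ (3 + c)))) (*-monoʳ-≤ (3 + c) 1≤L)

      log≤ : 1 + ⌊log₂ (1 + (g + g)) ⌋ ≤ L + 2 * L
      log≤ = begin
        -- 1 + 2 g is at most 2 (1 + g), whose logarithm is one more than that of 1 + g.
        1 + ⌊log₂ (1 + (g + g)) ⌋  ≤⟨ s≤s (⌊log₂⌋-mono-≤ (≤-trans (n≤1+n _) (≤-reflexive (double g)))) ⟩
        1 + ⌊log₂ (2 * suc g) ⌋    ≡⟨ cong suc (⌊log₂[2*b]⌋≡1+⌊log₂b⌋ (suc g)) ⟩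
        2 + ⌊log₂ suc g ⌋          ≡⟨ cong (λ n → 2 + ⌊log₂ n ⌋) (+-comm 1 g) ⟩
        2 + L                      ≤⟨ +-monoˡ-≤ L (*-monoʳ-≤ 2 1≤L) ⟩
        2 * L + L                  ≡⟨ +-comm (2 * L) L ⟩
        L + 2 * L                  ∎
        where
        double : ∀ g → 2 + (g + g) ≡ 2 * suc g
        double = solve-∀

      slack : ∀ a c l → suc c * (a * (l + 2 * l)) + a * ((3 + c) * l) + a * (l * (72 + 22 * c))
                      ≡ 26 * a * ((3 + c) * l)
      slack = solve-∀

-- Permutations, and the reports of parallel loops

module _ {A : Set} where

  ∈⇒↭∷ : ∀ {x : A} {xs} → x ∈ xs → ∃[ ys ] xs ↭ x ∷ ys
  ∈⇒↭∷ {x} x∈xs with ys , zs , refl ← ∈-∃++ x∈xs = ys ++ zs , ↭-shift x ys zs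

  ∈-∷⁻ : ∀ {x y : A} {ys} → x ≢ y → y ∈ x ∷ ys → y ∈ ys
  ∈-∷⁻ x≢y (here refl)  = contradiction refl x≢y
  ∈-∷⁻ x≢y (there y∈ys) = y∈ys

  -- Pigeonhole: the head of `xs` is removed from `ys`, and by uniqueness the tail of `xs` stays
  -- within what remains.
  length-⊆ : ∀ {xs ys : List A} → Unique xs → All (_∈ ys) xs → length xs ≤ length ys
  length-⊆ []             []             = z≤n
  length-⊆ (x∉xs ∷ xs!) (x∈ys ∷ xs⊆ys) with zs , ys↭ ← ∈⇒↭∷ x∈ys =
    ≤-trans (s≤s (length-⊆ xs! (All.zipWith (λ (x≢y , y∈ys) → ∈-∷⁻ x≢y (∈-resp-↭ ys↭ y∈ys)) (x∉xs , xs⊆ys))))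
            (≤-reflexive (sym (↭-length ys↭)))

  AllPairs-∷ʳ⁻ : ∀ {R : Rel A 0ℓ} xs {y} → AllPairs R (xs ∷ʳ y) → AllPairs R xs × All (λ x → R x y) xs
  AllPairs-∷ʳ⁻ []       _           = [] , []
  AllPairs-∷ʳ⁻ (x ∷ xs) (rxs ∷ rs) with rxs′ , rxy ← All.∷ʳ⁻ rxs | rs′ , rsy ← AllPairs-∷ʳ⁻ xs rs =
    rxs′ ∷ rs′ , rxy ∷ rsy

  AllPairs-resp-↭ : ∀ {R : Rel A 0ℓ} → Symmetric R → ∀ {xs ys} → xs ↭ ys → AllPairs R xs → AllPairs R ys
  AllPairs-resp-↭ {R} R-sym xs↭ys =
    Permutationₛ.AllPairs-resp-↭ (setoid A) R-sym (resp₂ R) (↭⇒↭ₛ xs↭ys)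

  if-accept : {P : Set} (B : Run A → Set) (P? : Dec P) {r s : Run A} →
              P → B r → B (if does P? then r else s)
  if-accept B P? {r} {s} p b = subst (λ b′ → B (if b′ then r else s)) (sym (dec-true P? p)) b

  module _ {B : Set} {P : A → Set} {f : B → Run A} where

    forAll-All : ∀ {xs} → All (λ x → All P (reports (f x))) xs → All P (reports (forAll xs f))
    forAll-All []       = []
    forAll-All (p ∷ ps) = All.++⁺ p (forAll-All ps)

    forAll-Any : ∀ {xs x} → x ∈ xs → Any P (reports (f x)) → Any P (reports (forAll xs f))
    forAll-Any (here refl) p = Any.++⁺ˡ p
    forAll-Any {y ∷ _} (there x∈xs) p = Any.++⁺ʳ (reports (f y)) (forAll-Any x∈xs p)

-- Correctness

module Listing (M : CostModel) (G : Graph) (O : VertexOrder G) where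

  open Algorithm M G O hiding (communityCliqueList)
  open CostModel M using (intersection)
  open Graph G
  open VertexOrder O
  open DecMembership (Fin._≟_ {n}) using (_∈?_)

  -- Distinctness comes for free, since adjacent vertices differ.
  isClique : ∀ {k K} → length K ≡ k → AllPairs Adj K → IsClique G k K
  isClique K≡ adj = K≡ , AllPairs.map (λ { uv refl → loopless uv }) adj , adj

  ∈-pairs⁻ : ∀ I d {u v} → (u , v) ∈ pairs I d → u ∈ I × v ∈ I
  ∈-pairs⁻ I d p∈ = ∈-cartesianProduct⁻ I I (proj₁ (∈-filter⁻ _ {xs = cartesianProduct I I} p∈))

  ∈-pairs⁺ : ∀ {I d u v} → u ∈ I → v ∈ I → u ≺ v → d ≤ δ I u v → (u , v) ∈ pairs I d
  ∈-pairs⁺ u∈I v∈I u≺v d≤δ = ∈-filter⁺ _ (∈-cartesianProduct⁺ u∈I v∈I) (u≺v , d≤δ)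

  -- The invariant is that `K` is pairwise adjacent and completely joined to `I`. Passing to the
  -- community of an arc keeps it, as the members are adjacent to both endpoints.
  recursiveCount-sound : ∀ c S K I {k} → suc c + length K ≡ k → AllPairs Adj K →
    All (λ w → All (Adj w) K) I → All (IsClique G k) (reports (recursiveCount S K I (suc c)))
  recursiveCount-sound zero S K I K≡ KK IK =
    forAll-All (All.map (λ wK → isClique K≡ (wK ∷ KK) ∷ []) IK)
  recursiveCount-sound (suc zero) S K I {k} K≡ KK IK = forAll-All (All.tabulate leaf)
    where
    leaf : ∀ {p} → p ∈ pairs I 0 → All (IsClique G k)
      (reports (if does (arc? (proj₁ p) (proj₂ p)) then reportClique (proj₁ p ∷ proj₂ p ∷ K) else idle))
    leaf {u , v} p∈ with u∈I , v∈I ← ∈-pairs⁻ I 0 p∈ =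
      if-elim (λ r → All (IsClique G k) (reports r)) (arc? u v)
        (λ (_ , uv) → isClique K≡ ((uv ∷ All.lookup IK u∈I) ∷ All.lookup IK v∈I ∷ KK) ∷ [])
        []
  recursiveCount-sound (suc (suc c)) S K I {k} K≡ KK IK = forAll-All (All.tabulate branch)
    where
    branch : ∀ {p} → p ∈ pairs I (suc c) → All (IsClique G k)
      (reports (if does (arc? (proj₁ p) (proj₂ p))
        then intersection (length I) (length (community S (proj₁ p) (proj₂ p))) ⨾
             recursiveCount S (proj₁ p ∷ proj₂ p ∷ K) (I ∩ community S (proj₁ p) (proj₂ p)) (suc c)
        else idle))
    branch {u , v} p∈ with u∈I , v∈I ← ∈-pairs⁻ I (suc c) p∈ =
      if-elim (λ r → All (IsClique G k) (reports r)) (arc? u v)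
        (λ (_ , uv) → recursiveCount-sound c S (u ∷ v ∷ K) (I ∩ community S u v) (trans (pair-+ c (length K)) K≡)
          ((uv ∷ All.lookup IK u∈I) ∷ All.lookup IK v∈I ∷ KK)
          (All.tabulate joined))
        []
      where
      joined : ∀ {w} → w ∈ I ∩ community S u v → All (Adj w) (u ∷ v ∷ K)
      joined w∈ with w∈I , w∈C ← ∈-filter⁻ (_∈? community S u v) {xs = I} w∈
                with (_ , uw) , (_ , wv) ← proj₂ (∈-filter⁻ _ {xs = S} w∈C) =
        adj-sym uw ∷ wv ∷ All.lookup IK w∈I

  -- `L` is the missing part of the clique in increasing vertex order. It has to lie in `S` as well
  -- as in `I`, because the communities are taken within `S`.
  recursiveCount-complete : ∀ c S K I L → length L ≡ suc c → AllPairs Arc L →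
    All (_∈ I) L → All (_∈ S) L → Any (L ++ K ↭_) (reports (recursiveCount S K I (suc c)))
  recursiveCount-complete zero S K I (w ∷ []) _ _ (w∈I ∷ []) _ = forAll-Any w∈I (here ↭-refl)
  recursiveCount-complete (suc zero) S K I (u ∷ v ∷ []) _ ((u→v ∷ []) ∷ _) (u∈I ∷ v∈I ∷ []) _ =
    forAll-Any (∈-pairs⁺ u∈I v∈I (proj₁ u→v) z≤n)
      (if-accept (λ r → Any (u ∷ v ∷ K ↭_) (reports r)) (arc? u v) u→v (here ↭-refl))
  recursiveCount-complete (suc (suc c)) S K I (u ∷ L′) |L|≡ (u→L′ ∷ L′↗) (u∈I ∷ L′⊆I) (u∈S ∷ L′⊆S)
    with initLast L′
  ... | L ∷ʳ′ v
    with L↗ , L→v ← AllPairs-∷ʳ⁻ L L′↗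
       | u→L , u→v ← All.∷ʳ⁻ u→L′
       | L⊆I , v∈I ← All.∷ʳ⁻ L′⊆I
       | L⊆S , v∈S ← All.∷ʳ⁻ L′⊆S =
    forAll-Any (∈-pairs⁺ u∈I v∈I (proj₁ u→v) d≤δ)
      (if-accept (λ r → Any ((u ∷ L ∷ʳ v) ++ K ↭_) (reports r)) (arc? u v) u→v
        (Any.map (↭-trans rearrange)
          (recursiveCount-complete c S (u ∷ v ∷ K) (I ∩ community S u v) L |L|≡′ L↗
            (All.zipWith (λ (w∈I , w∈C) → ∈-filter⁺ (_∈? community S u v) w∈I w∈C) (L⊆I , L⊆C)) L⊆S)))
    where
    |L|≡′ : length L ≡ suc c
    |L|≡′ = suc-injective (trans (sym (trans (length-++ L) (+-comm (length L) 1))) (suc-injective |L|≡))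

    L⊆C : All (_∈ community S u v) L
    L⊆C = All.zipWith (λ (w∈S , u→w , w→v) → ∈-filter⁺ _ w∈S (u→w , w→v)) (L⊆S , All.zip (u→L , L→v))

    -- The remaining `suc c` vertices are distinct and lie between u and v, so the threshold never
    -- discards a pair that is needed.
    d≤δ : suc c ≤ δ I u v
    d≤δ = subst (_≤ δ I u v) |L|≡′ (length-⊆
      (AllPairs.map (λ { (_ , uw) refl → loopless uw }) L↗)
      (All.zipWith (λ (w∈I , u→w , w→v) → ∈-filter⁺ _ w∈I (proj₁ u→w , proj₁ w→v)) (L⊆I , All.zip (u→L , L→v))))

    rearrange : (u ∷ L ∷ʳ v) ++ K ↭ L ++ u ∷ v ∷ K
    rearrange = begin
      u ∷ (L ++ [ v ]) ++ K  ≡⟨ cong (u ∷_) (++-assoc L [ v ] K) ⟩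
      u ∷ L ++ v ∷ K         ↭⟨ ↭-shift u L (v ∷ K) ⟨
      L ++ u ∷ v ∷ K         ∎
      where open PermutationReasoning

-- Edges, and the least edge of a clique

module _ (G : Graph) where

  open Graph G using (Adj; adj?; adj-sym; loopless; n)
  open DecMembership (Fin._≟_ {n}) using (_∈?_)
  open Edge using (lo; hi)

  -- The proof stored in an edge is irrelevant; decidability of adjacency recovers a usable one.
  edge-adj : (e : Edge G) → Adj (lo e) (hi e)
  edge-adj (edge u v _ uv) = recompute (adj? u v) uv

  ∈-edges : ∀ {u v} (u<v : u Fin.< v) (uv : Adj u v) → edge u v u<v uv ∈ edges G
  ∈-edges {u} {v} u<v uv = Any.mapMaybe⁺ (toEdge G) (cartesianProduct (allFin _) (allFin _))
    (Any.map⁺ (Any.map (λ { refl → listed }) (∈-cartesianProduct⁺ (∈-allFin u) (∈-allFin v))))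
    where
    listed : Maybe.Any (edge u v u<v uv ≡_) (toEdge G (u , v))
    listed with u Fin.<? v | adj? u v
    -- The tests may return other proofs, but edges with the same endpoints are equal.
    ... | yes _   | yes _  = Maybe.just refl
    ... | yes _   | no ¬uv = contradiction uv ¬uv
    ... | no u≮v | _      = contradiction u<v u≮v

  joining-edge : ∀ {u v} → Adj u v → ∃[ f ] f ∈ edges G × Joins u v f
  joining-edge {u} {v} uv with Fin.<-cmp u v
  ... | tri< u<v _ _  = edge u v u<v uv , ∈-edges u<v uv , inj₁ (refl , refl)
  ... | tri≈ _ refl _ = contradiction uv loopless
  ... | tri> _ _ v<u  = edge v u v<u (adj-sym uv) , ∈-edges v<u (adj-sym uv) , inj₂ (refl , refl)

  adjIn⇒adj : ∀ {F u v} → AdjIn F u v → Adj u v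
  adjIn⇒adj u~v with find u~v
  ... | f , _ , inj₁ (refl , refl) = edge-adj f
  ... | f , _ , inj₂ (refl , refl) = adj-sym (edge-adj f)

  module _ (P : EdgeOrder G) where

    open EdgeOrder P

    private
      ⪯-totalOrder : TotalOrder 0ℓ 0ℓ 0ℓ
      ⪯-totalOrder = record { isTotalOrder = IsDecTotalOrder.isTotalOrder isDecTotalOrder }

    V′⇒adj : ∀ e {w} → w ∈ V′ P e → Adj w (lo e) × Adj w (hi e)
    V′⇒adj e w∈ with lo~w , hi~w ← proj₂ (∈-filter⁻ _ {xs = allFin _} w∈) =
      adj-sym (adjIn⇒adj lo~w) , adj-sym (adjIn⇒adj hi~w)

    clique-split : ∀ {k K} → IsClique G (2 + k) K →
      ∃[ e ] e ∈ edges G × ∃[ L ] K ↭ lo e ∷ hi e ∷ L × All (_∈ V′ P e) L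
    clique-split {K = K@(x ∷ y ∷ _)} (_ , _ , KK@((xy ∷ _) ∷ _)) =
      e , e∈edges , L , K↭ , All.zipWith (λ (lo~w , hi~w) → ∈-filter⁺ _ (∈-allFin _) (lo~w , hi~w))
        ( All.zipWith (λ (w∈K , uw) → adjIn-tail lo∈K w∈K uw) (L⊆K , All.tail lo-adj)
        , All.zipWith (λ (w∈K , uw) → adjIn-tail hi∈K w∈K uw) (L⊆K , hi-adj))
      where
      open Extrema ⪯-totalOrder using (min; min≤xs; argmin-sel)

      within? : ∀ f → Dec (lo f ∈ K × hi f ∈ K)
      within? f = (lo f ∈? K) ×-dec (hi f ∈? K)

      joins-within : ∀ {u v} → u ∈ K → v ∈ K → ∀ f → Joins u v f → lo f ∈ K × hi f ∈ K
      joins-within u∈K v∈K f (inj₁ (refl , refl)) = u∈K , v∈K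
      joins-within u∈K v∈K f (inj₂ (refl , refl)) = v∈K , u∈K

      F = filter within? (edges G)

      first = joining-edge xy

      -- `min` requires a default. The edge joining the first two vertices of `K` belongs to `F`
      -- itself, so `e` does in either case.
      e = min (proj₁ first) F

      e∈F : e ∈ F
      e∈F with argmin-sel id (proj₁ first) F
      ... | inj₂ e∈F = e∈F
      ... | inj₁ e≡  = subst (_∈ F) (sym e≡) (∈-filter⁺ within? (proj₁ (proj₂ first))
                         (joins-within (here refl) (there (here refl)) (proj₁ first) (proj₂ (proj₂ first))))

      e∈edges : e ∈ edges G
      e∈edges = proj₁ (∈-filter⁻ within? {xs = edges G} e∈F)

      lo∈K : lo e ∈ K
      lo∈K = proj₁ (proj₂ (∈-filter⁻ within? {xs = edges G} e∈F))

      hi∈K : hi e ∈ K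
      hi∈K = proj₂ (proj₂ (∈-filter⁻ within? {xs = edges G} e∈F))

      K↭lo∷ = proj₂ (∈⇒↭∷ lo∈K)

      lo≢hi : lo e ≢ hi e
      lo≢hi lo≡hi = loopless (subst (Adj (lo e)) (sym lo≡hi) (edge-adj e))

      rest = ∈⇒↭∷ (∈-∷⁻ lo≢hi (∈-resp-↭ K↭lo∷ hi∈K))

      L = proj₁ rest

      K↭ : K ↭ lo e ∷ hi e ∷ L
      K↭ = ↭-trans K↭lo∷ (prep (lo e) (proj₂ rest))

      L⊆K : All (_∈ K) L
      L⊆K = All.tabulate (λ w∈L → ∈-resp-↭ (↭-sym K↭) (there (there w∈L)))

      adjacent : AllPairs Adj (lo e ∷ hi e ∷ L)
      adjacent = AllPairs-resp-↭ adj-sym K↭ KK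

      lo-adj = AllPairs.head adjacent
      hi-adj = AllPairs.head (AllPairs.tail adjacent)

      adjIn-tail : ∀ {u w} → u ∈ K → w ∈ K → Adj u w → AdjIn (E[ P ⪯] e) u w
      adjIn-tail u∈K w∈K uw with f , f∈ , u-f-w ← joining-edge uw =
        -- Every edge inside `K` lies in `F`, so minimality of `e` puts it into `E[ e ⪯]`.
        lose (∈-filter⁺ (e ⪯?_) f∈ (All.lookup (min≤xs (proj₁ first) F)
               (∈-filter⁺ within? f∈ (joins-within u∈K w∈K f u-f-w)))) u-f-w

-- Soundness and completeness of the whole algorithm

module _ (M : CostModel) (G : Graph) (O : VertexOrder G) (P : EdgeOrder G) where

  open Algorithm M G O hiding (communityCliqueList)
  open Listing M G O
  open Graph G
  open VertexOrder O
  open Edge using (lo; hi)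

  communityCliqueList-sound : ∀ c →
    All (IsClique G (3 + c)) (reports (communityCliqueList M G O P (3 + c)))
  communityCliqueList-sound c = forAll-All (All.universal
    (λ e → recursiveCount-sound c (V′ P e) (lo e ∷ hi e ∷ []) (V′ P e) (+-comm (suc c) 2)
      ((edge-adj G e ∷ []) ∷ [] ∷ [])
      (All.tabulate (λ w∈ → proj₁ (V′⇒adj G P e w∈) ∷ proj₂ (V′⇒adj G P e w∈) ∷ [])))
    (edges G))

  communityCliqueList-complete : ∀ c K → IsClique G (3 + c) K →
    Any (K ↭_) (reports (communityCliqueList M G O P (3 + c)))
  communityCliqueList-complete c K cl@(|K|≡ , K! , KK)
    with e , e∈ , L′ , K↭ , L′⊆V′ ← clique-split G P cl
    with _ ∷ _ ∷ L′! ← AllPairs-resp-↭ (λ u≢v → u≢v ∘ sym) K↭ K!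
    with _ ∷ _ ∷ L′L′ ← AllPairs-resp-↭ adj-sym K↭ KK
    -- The edge order has selected `e`; the vertices left over are now arranged by the vertex order,
    -- which turns their adjacencies into arcs.
    with L , L′↭L , L↗ ← sort-strictly isStrictTotalOrder L′! =
    forAll-Any e∈ (Any.map (↭-trans K↭L++)
      (recursiveCount-complete c (V′ P e) (lo e ∷ hi e ∷ []) (V′ P e) L |L|≡
        (AllPairs.zip (L↗ , AllPairs-resp-↭ adj-sym L′↭L L′L′)) L⊆V′ L⊆V′))
    where
    L⊆V′ = All-resp-↭ L′↭L L′⊆V′

    |L|≡ : length L ≡ suc c
    |L|≡ = trans (sym (↭-length L′↭L)) (suc-injective (suc-injective (trans (sym (↭-length K↭)) |K|≡)))

    K↭L++ : K ↭ L ++ lo e ∷ hi e ∷ []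
    K↭L++ = ↭-trans K↭ (↭-trans (prep (lo e) (prep (hi e) L′↭L)) (++-comm (lo e ∷ hi e ∷ []) L))

-- The bounds in terms of k and γ

k<g+2⇒excess : ∀ {c g} → 4 + c < g + 2 → ∃[ l ] g ≡ 1 + l + (2 + c)
-- With k = 4 + c the witness satisfies 3 + l = γ + 4 - k, the base of the power in the bound.
k<g+2⇒excess {c} {g} k<g+2 = g ∸ (3 + c) , trans (sym (m∸n+n≡m 3+c≤g)) (+-suc (g ∸ (3 + c)) (2 + c))
  where
  3+c≤g : 3 + c ≤ g
  3+c≤g = s≤s⁻¹ (s≤s⁻¹ (subst (5 + c ≤_) (+-comm g 2) k<g+2))

theorem4p3 : (M : CostModel) →
  ∃[ C ] ((G : Graph) → Connected G →
    (O : VertexOrder G) (P : EdgeOrder G) (k : ℕ) → 4 ≤ k →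
    let m = #edges G
        g = γ P
        R = communityCliqueList M G O P k
        W = work (cost R)
        T = depth (cost R)
    in
    -- the k-cliques of G, and nothing else, are listed
    (All (IsClique G k) (reports R) × (∀ K → IsClique G k K → Any (K ↭_) (reports R)))
    -- W = O (k m ((γ + 4 - k) / 2) ^ (k - 2))
    × (k < g + 2 → W * 2 ^ (k ∸ 2) ≤ C * (k * m * (g + 4 ∸ k) ^ (k ∸ 2)))
    -- where (γ + 4 - k) / 2 is 1 or less that bound fails (linear-time intersections,
    -- resp. the loop over E alone), and these hold instead
    × (k ≡ g + 2 → W ≤ C * (k * (k * m)))
    × (g + 2 < k → W ≤ C * m)
    -- T = O (k log (γ + 1)); the maximum with 1 matters only when γ = 0
    × (T ≤ C * (1 ⊔ k * ⌊log₂ (g + 1) ⌋)))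
theorem4p3 M = 26 * A , λ { G _ O P (suc (suc (suc (suc c)))) (s≤s (s≤s (s≤s (s≤s z≤n)))) →
    (communityCliqueList-sound M G O P (1 + c) , communityCliqueList-complete M G O P (1 + c))
  , above G O P c
  , (λ k≡g+2 → boundary-work G O P (1 + c)
      (sym (suc-injective (suc-injective (trans k≡g+2 (+-comm (γ P) 2))))))
  , (λ g+2<k → idle-work G O P c
      (s≤s⁻¹ (s≤s⁻¹ (s≤s⁻¹ (subst (λ x → suc x ≤ 4 + c) (+-comm (γ P) 2) g+2<k)))))
  , total-depth G O P c }
  where
  open TotalCost M

  above : ∀ G O P c → let k = 4 + c; g = γ P in k < g + 2 →
    work (cost (communityCliqueList M G O P k)) * 2 ^ (2 + c)
      ≤ 26 * A * (k * #edges G * (g + 4 ∸ k) ^ (2 + c))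
  above G O P c k<g+2 with l , g≡ ← k<g+2⇒excess k<g+2 =
    ≤-trans (work-bound G O P (1 + c) l g≡)
            (≤-reflexive (cong (λ t → 26 * A * ((4 + c) * #edges G * t ^ (2 + c))) (sym base≡)))
    where
    rearrange : ∀ l c → 1 + l + (2 + c) + 4 ≡ (4 + c) + (3 + l)
    rearrange = solve-∀
    base≡ : γ P + 4 ∸ (4 + c) ≡ 3 + l
    base≡ = trans (cong (_∸ (4 + c)) (trans (cong (_+ 4) g≡) (rearrange l c))) (m+n∸m≡n (4 + c) (3 + l))

  total-depth : ∀ G O P c → let k = 4 + c in
    depth (cost (communityCliqueList M G O P k)) ≤ 26 * A * (1 ⊔ k * ⌊log₂ (γ P + 1) ⌋)
  total-depth G O P c with 1 ≤? γ P
  ... | yes 1≤g = ≤-trans (depth-bound G O P (1 + c) 1≤g) (*-monoʳ-≤ (26 * A) (m≤n⊔m 1 ((4 + c) * ⌊log₂ (γ P + 1) ⌋)))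
  -- Here γ = 0 and the logarithm vanishes. Since k is at least 4 all loops inside the calls are
  -- empty, and the constant depth is covered by the 1 in the maximum.
  ... | no  1≰g = ≤-trans (idle-depth G O P c (≤-trans (s≤s⁻¹ (≰⇒> 1≰g)) z≤n))
                    (≤-trans (≤-reflexive (sym (*-identityʳ (26 * A)))) (*-monoʳ-≤ (26 * A) (m≤m⊔n 1 ((4 + c) * ⌊log₂ (γ P + 1) ⌋))))
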